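{- There exist infinitely many $2$-layer $5$-planar graphs with $n$ vertices and $\frac{9}{4}n-\frac{9}{2}$ edges; that is, for infinitely many values of $n$ there is a $2$-layer $5$-planar graph with exactly $n$ vertices and exactly $\frac{9}{4}n-\frac{9}{2}$ edges.
   Context: All graphs are finite and simple (no loops or parallel edges). A topological $2$-layer graph is a bipartite graph $G=(U\,\dot\cup\,V,E)$, $E\subseteq U\times V$, drawn in the plane so that the vertices of $U$ and of $V$ are distinct points on two horizontal lines $L_u$ and $L_v$, respectively, and edges are $y$-monotone Jordan arcs; the drawing is assumed simple, i.e. adjacent edges do not cross and independent edges cross at most once. Denote the vertices by $u_1,\dots,u_p$ along $L_u$ and $v_1,\dots,v_q$ along $L_v$ in left-to-right order, $n=p+q$. (Thus edges $(u_i,v_x)$ and $(u_j,v_y)$ with $i<j$ cross if and only if $x>y$.) A topological $2$-layer graph is $k$-planar if each edge is crossed at most $k$ times. A bipartite graph is $2$-layer $k$-planar if it is isomorphic to the underlying abstract graph of some topological $2$-layer $k$-planar graph. -}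

module Defs where

open import Data.Bool.Base using (Bool)
open import Data.Empty using (⊥)
open import Data.Fin.Base using (Fin; _<_)
open import Data.Fin.Properties using (_<?_)
open import Data.List.Base using (List; allFin; cartesianProduct; filter; length)
open import Data.Nat.Base using (ℕ; _≤_)
open import Data.Product.Base using (Σ-syntax; ∃-syntax; _×_; _,_; uncurry)
open import Data.Sum.Base using (_⊎_; inj₁; inj₂)
open import Function.Bundles using (_↔_; _⇔_; Inverse)
open import Level using (0ℓ)
open import Relation.Binary.Core using (REL; Rel)
open import Relation.Binary.Definitions using (Decidable; Irreflexive; Symmetric)
open import Relation.Binary.PropositionalEquality.Core using (_≡_; _≢_; refl)
open import Relation.Nullary.Decidable using (no; _×-dec_; _⊎-dec_)

record Graph (V : Set) : Set₁ where
  field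
    Adj    : Rel V 0ℓ
    adj?   : Decidable Adj
    sym    : Symmetric Adj
    irrefl : Irreflexive _≡_ Adj

open Graph

-- Each edge is listed once, with its smaller endpoint first.
edges : ∀ {n} → Graph (Fin n) → List (Fin n × Fin n)
edges {n} G =
  filter (λ (i , j) → i <? j ×-dec adj? G i j)
         (cartesianProduct (allFin n) (allFin n))

record _≅_ {V W : Set} (G : Graph V) (H : Graph W) : Set where
  field
    bijection : V ↔ W
    preserves : ∀ x y → Adj G x y ⇔ Adj H (Inverse.to bijection x) (Inverse.to bijection y)

Bipartite : {V : Set} → Graph V → Set
Bipartite {V} G = Σ[ side ∈ (V → Bool) ] (∀ x y → Adj G x y → side x ≢ side y)

-- A simple topological 2-layer graph, up to the choice of arcs: Fin p and Fin q
-- are the vertices on the two lines in left-to-right order.  Since simplicity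
-- and y-monotonicity make the crossing pairs depend only on these orders, no
-- further data of the drawing is kept.
record TwoLayer (p q : ℕ) : Set₁ where
  field
    Edge  : REL (Fin p) (Fin q) 0ℓ
    edge? : Decidable Edge

open TwoLayer

Cross : ∀ {p q} → Rel (Fin p × Fin q) 0ℓ
Cross (i , x) (j , y) = (i < j × y < x) ⊎ (j < i × x < y)

cross? : ∀ {p q} → Decidable (Cross {p} {q})
cross? (i , x) (j , y) = (i <? j ×-dec y <? x) ⊎-dec (j <? i ×-dec x <? y)

layerEdges : ∀ {p q} → TwoLayer p q → List (Fin p × Fin q)
layerEdges {p} {q} D = filter (uncurry (edge? D)) (cartesianProduct (allFin p) (allFin q))

crossings : ∀ {p q} → TwoLayer p q → Fin p × Fin q → ℕ
crossings D e = length (filter (cross? e) (layerEdges D))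

KPlanar : ∀ {p q} → ℕ → TwoLayer p q → Set
KPlanar k D = ∀ i x → Edge D i x → crossings D (i , x) ≤ k

underlying : ∀ {p q} → TwoLayer p q → Graph (Fin p ⊎ Fin q)
underlying {p} {q} D = record
  { Adj    = A
  ; adj?   = A?
  ; sym    = λ {a} {b} → A-sym a b
  ; irrefl = λ {a} → A-irrefl a
  }
  where
  A : Rel (Fin p ⊎ Fin q) 0ℓ
  A (inj₁ i) (inj₂ x) = Edge D i x
  A (inj₂ x) (inj₁ i) = Edge D i x
  A (inj₁ _) (inj₁ _) = ⊥
  A (inj₂ _) (inj₂ _) = ⊥

  A? : Decidable A
  A? (inj₁ i) (inj₂ x) = edge? D i x
  A? (inj₂ x) (inj₁ i) = edge? D i x
  A? (inj₁ _) (inj₁ _) = no λ ()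
  A? (inj₂ _) (inj₂ _) = no λ ()

  A-sym : ∀ a b → A a b → A b a
  A-sym (inj₁ _) (inj₂ _) e = e
  A-sym (inj₂ _) (inj₁ _) e = e

  A-irrefl : ∀ a {b} → a ≡ b → A a b → ⊥
  A-irrefl (inj₁ _) refl ()
  A-irrefl (inj₂ _) refl ()

TwoLayerKPlanar : {V : Set} → ℕ → Graph V → Set₁
TwoLayerKPlanar k G =
  Bipartite G ×
  (∃[ p ] ∃[ q ] Σ[ D ∈ TwoLayer p q ] (KPlanar k D × G ≅ underlying D))

{-# OPTIONS --safe #-}
-- Glue m copies of K₃,₃ in a chain, consecutive copies sharing an edge, and
-- add at each junction one edge between the centres of the two copies; this
-- gives 9m edges on 4m + 2 vertices.  An added edge puts a fifth crossing on
-- one corner edge of each of the two copies, so the added edges must alternate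
-- in direction for a copy to have its two corner edges loaded once each.
-- Numbering both layers from 0, u_i and v_x are adjacent iff ∣ i - x ∣ ≤ 1, or
-- ∣ i - x ∣ = 2 and i ≢ 3 mod 4, a drawing that is invariant under shifting
-- both layers by 4.
module Submission where

open import Data.Bool.Base using (Bool; true; false)
open import Data.Empty using (⊥; ⊥-elim)
open import Data.Fin.Base as Fin using (Fin; toℕ; fromℕ<; splitAt; _↑ˡ_; _↑ʳ_)
open import Data.Fin.Properties as Fin
  using (toℕ<n; toℕ-fromℕ<; toℕ-injective; toℕ-↑ˡ; toℕ-↑ʳ; ↑ˡ-injective; ↑ʳ-injective;
         splitAt-↑ˡ; splitAt-↑ʳ; splitAt⁻¹-↑ˡ; splitAt⁻¹-↑ʳ; +↔⊎)
open import Data.Integer.Base as ℤ using (+_)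
import Data.Integer.Properties as ℤ
import Data.Integer.Tactic.RingSolver as ℤRing
open import Data.List.Base
  using (List; []; _∷_; _++_; map; filter; length; upTo; allFin; cartesianProduct)
open import Data.List.Properties using (length-map; length-++; length-++-sucʳ)
open import Data.List.Membership.Propositional using (_∈_)
open import Data.List.Membership.Propositional.Properties
open import Data.List.Relation.Binary.Subset.Propositional using (_⊆_)
open import Data.List.Relation.Unary.All using (lookup)
open import Data.List.Relation.Unary.AllPairs using ([]; _∷_)
open import Data.List.Relation.Unary.Any using (here; there)
open import Data.List.Relation.Unary.Unique.Propositional using (Unique)
import Data.List.Relation.Unary.Unique.Propositional.Properties as Unique
open import Data.Nat.Base as ℕ
  using (ℕ; zero; suc; _+_; _<_; _≤_; z≤n; s≤s; ∣_-_∣)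
open import Data.Nat.DivMod using (_%_)
open import Data.Nat.Induction using (Acc; acc; <-wellFounded)
open import Data.Nat.Properties as ℕ hiding (_≟_; _≤?_; _<?_)
open import Data.Nat.Tactic.RingSolver using (solve-∀)
open import Data.Product.Base using (Σ-syntax; ∃-syntax; _×_; _,_; proj₁; proj₂; uncurry)
open import Data.Rational.Base using (_/_; _*_; _-_; -_; toℚᵘ)
import Data.Rational.Properties as ℚ
open import Data.Rational.Unnormalised.Base as ℚᵘ using (*≡*)
import Data.Rational.Unnormalised.Properties as ℚᵘ
open import Data.Sum.Base using (_⊎_; inj₁; inj₂)
open import Function.Base using (_∘_)
open import Function.Bundles using (_↔_; Inverse)
open import Function.Properties.Equivalence using (⇔-isEquivalence)
open import Level using (0ℓ)
open import Relation.Binary.Core using (Rel)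
open import Relation.Binary.Definitions using (Decidable)
open import Relation.Binary.PropositionalEquality
  using (_≡_; _≢_; refl; sym; trans; cong; cong₂; subst; subst₂; module ≡-Reasoning)
open import Relation.Binary.Structures using (IsEquivalence)
open import Relation.Nullary.Decidable
  using (Dec; yes; no; toWitness; ¬?; _×-dec_; _⊎-dec_; _→-dec_)
open import Defs

-- Lengths of duplicate-free lists

-- Induction on `xs`: cut `ys` around an occurrence of the head; the tail avoids the head, so it
-- lies in what remains. All list lengths below are compared by two inclusions of duplicate-free
-- lists.
unique-⊆⇒length≤ : ∀ {A : Set} {xs ys : List A} → Unique xs → xs ⊆ ys → length xs ≤ length ys
unique-⊆⇒length≤ [] _ = z≤n
unique-⊆⇒length≤ {xs = x ∷ xs} (x∉xs ∷ u) sub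
  with as , bs , refl ← ∈-∃++ (sub (here refl)) =
  subst (suc (length xs) ≤_) (sym (length-++-sucʳ as x bs)) (s≤s (unique-⊆⇒length≤ u sub′))
  where
  sub′ : xs ⊆ as ++ bs
  sub′ z∈xs with ∈-++⁻ as (sub (there z∈xs))
  ... | inj₁ z∈as         = ∈-++⁺ˡ z∈as
  ... | inj₂ (here refl)  = ⊥-elim (lookup x∉xs z∈xs refl)
  ... | inj₂ (there z∈bs) = ∈-++⁺ʳ as z∈bs

∈-filter-×⁺ : ∀ {A B : Set} {P : A × B → Set} (P? : ∀ z → Dec (P z)) {xs ys a b} →
              a ∈ xs → b ∈ ys → P (a , b) → (a , b) ∈ filter P? (cartesianProduct xs ys)
∈-filter-×⁺ P? a∈xs b∈ys = ∈-filter⁺ P? (∈-cartesianProduct⁺ a∈xs b∈ys)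

unique-filter-× : ∀ {A B : Set} {P : A × B → Set} (P? : ∀ z → Dec (P z)) {xs ys} →
                  Unique xs → Unique ys → Unique (filter P? (cartesianProduct xs ys))
unique-filter-× P? u v = Unique.filter⁺ P? (Unique.cartesianProduct⁺ u v)

-- From a drawing to a graph on `Fin (p + q)`

-- This is why `edges`, which puts the smaller endpoint first, always lists the end on the first
-- layer first.
↑ˡ<↑ʳ : ∀ {p q} (i : Fin p) (x : Fin q) → (i ↑ˡ q) Fin.< (p ↑ʳ x)
↑ˡ<↑ʳ {p} {q} i x rewrite toℕ-↑ˡ i q | toℕ-↑ʳ p x = ≤-trans (toℕ<n i) (m≤m+n p (toℕ x))

pullback : ∀ {V W : Set} → (V → W) → Graph W → Graph V
pullback f G = record
  { Adj    = λ x y → Adj (f x) (f y)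
  ; adj?   = λ x y → adj? (f x) (f y)
  ; sym    = symm
  ; irrefl = λ x≡y → irrefl (cong f x≡y)
  }
  where open Graph G renaming (sym to symm)

pullback-≅ : ∀ {V W : Set} (f : V ↔ W) (G : Graph W) → pullback (Inverse.to f) G ≅ G
pullback-≅ f G = record
  { bijection = f ; preserves = λ _ _ → IsEquivalence.refl ⇔-isEquivalence }

module _ {p q : ℕ} (D : TwoLayer p q) where
  open TwoLayer D

  -- The theorem asks for vertex set `Fin n`, whereas `underlying D` lives on a sum; `splitAt p`
  -- numbers the first layer before the second.
  linearGraph : Graph (Fin (p + q))
  linearGraph = pullback (splitAt p) (underlying D)

  linearGraph-bipartite : Bipartite linearGraph
  linearGraph-bipartite = side ∘ splitAt p , λ x y → proper (splitAt p x) (splitAt p y)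
    where
    side : Fin p ⊎ Fin q → Bool
    side (inj₁ _) = true
    side (inj₂ _) = false

    proper : ∀ a b → Graph.Adj (underlying D) a b → side a ≢ side b
    proper (inj₁ _) (inj₂ _) _ ()
    proper (inj₂ _) (inj₁ _) _ ()

  linearGraph-kPlanar : ∀ {k} → KPlanar k D → TwoLayerKPlanar k linearGraph
  linearGraph-kPlanar k-planar =
    linearGraph-bipartite , p , q , D , k-planar , pullback-≅ +↔⊎ (underlying D)

  layerEdges-unique : Unique (layerEdges D)
  layerEdges-unique = unique-filter-× (uncurry edge?) (Unique.allFin⁺ p) (Unique.allFin⁺ q)

  private
    embed : Fin p × Fin q → Fin (p + q) × Fin (p + q)
    embed (i , x) = i ↑ˡ q , p ↑ʳ x

    embed-injective : ∀ {e f} → embed e ≡ embed f → e ≡ f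
    embed-injective {i , x} {j , y} eq =
      cong₂ _,_ (↑ˡ-injective q i j (cong proj₁ eq)) (↑ʳ-injective p x y (cong proj₂ eq))

    edges? : ∀ ((i , j) : Fin (p + q) × Fin (p + q)) → Dec (i Fin.< j × Graph.Adj linearGraph i j)
    edges? (i , j) = i Fin.<? j ×-dec Graph.adj? linearGraph i j

    edges⊆ : edges linearGraph ⊆ map embed (layerEdges D)
    edges⊆ {a , b} ab∈ with proj₂ (∈-filter⁻ edges? {xs = cartesianProduct (allFin _) (allFin _)} ab∈)
    ... | a<b , adj with splitAt p a in eqa | splitAt p b in eqb
    ... | inj₁ i | inj₂ x
      with refl ← splitAt⁻¹-↑ˡ {p} eqa | refl ← splitAt⁻¹-↑ʳ {p} eqb =
      ∈-map⁺ embed (∈-filter-×⁺ (uncurry edge?) (∈-allFin i) (∈-allFin x) adj)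
    ... | inj₂ x | inj₁ i
      with refl ← splitAt⁻¹-↑ʳ {p} eqa | refl ← splitAt⁻¹-↑ˡ {p} eqb =
      ⊥-elim (<-asym a<b (↑ˡ<↑ʳ i x))

    ⊆edges : map embed (layerEdges D) ⊆ edges linearGraph
    ⊆edges e∈ with (i , x) , ix∈ , refl ← ∈-map⁻ embed e∈ =
      ∈-filter-×⁺ edges? (∈-allFin (i ↑ˡ q)) (∈-allFin (p ↑ʳ x)) (↑ˡ<↑ʳ i x , adj)
      where
      adj : Graph.Adj linearGraph (i ↑ˡ q) (p ↑ʳ x)
      adj rewrite splitAt-↑ˡ p i q | splitAt-↑ʳ p q x =
        proj₂ (∈-filter⁻ (uncurry edge?) {xs = cartesianProduct (allFin _) (allFin _)} ix∈)

  length-edges : length (edges linearGraph) ≡ length (layerEdges D)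
  length-edges = trans
    (≤-antisym
      (unique-⊆⇒length≤ (unique-filter-× edges? (Unique.allFin⁺ _) (Unique.allFin⁺ _)) edges⊆)
      (unique-⊆⇒length≤ (Unique.map⁺ embed-injective layerEdges-unique) ⊆edges))
    (length-map embed (layerEdges D))

-- The periodic edge pattern

-- Copy k of K₃,₃ occupies the indices 2k to 2k + 2 of both layers. Pairs at distance 2 with i even
-- are corner edges of copies; those with i odd join centres of neighbouring copies. Of the two such
-- pairs at a junction exactly one has i ≡ 1 mod 4, and its direction alternates along the chain.
E : Rel ℕ 0ℓ
E i x = ∣ i - x ∣ ≤ 1 ⊎ (∣ i - x ∣ ≡ 2 × i % 4 ≢ 3)

E? : Decidable E
E? i x = ∣ i - x ∣ ℕ.≤? 1 ⊎-dec (∣ i - x ∣ ℕ.≟ 2 ×-dec ¬? (i % 4 ℕ.≟ 3))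

E⇒∣-∣≤2 : ∀ {i x} → E i x → ∣ i - x ∣ ≤ 2
E⇒∣-∣≤2 (inj₁ d≤1)       = ≤-trans d≤1 (s≤s z≤n)
E⇒∣-∣≤2 (inj₂ (d≡2 , _)) = ≤-reflexive d≡2

E⇒i≤2+x : ∀ {i x} → E i x → i ≤ 2 + x
E⇒i≤2+x {i} {x} e = ≤-trans (m≤∣m-n∣+n i x) (+-monoˡ-≤ x (E⇒∣-∣≤2 {i} {x} e))

E⇒x≤2+i : ∀ {i x} → E i x → x ≤ 2 + i
E⇒x≤2+i {i} {x} e = ≤-trans (m≤n+∣n-m∣ x i) (≤-trans (+-monoʳ-≤ i (E⇒∣-∣≤2 {i} {x} e)) (≤-reflexive (+-comm i 2)))

gridEdges : ℕ → List (ℕ × ℕ)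
gridEdges n = filter (uncurry E?) (cartesianProduct (upTo n) (upTo n))

∈-gridEdges⁺ : ∀ {n i x} → i < n → x < n → E i x → (i , x) ∈ gridEdges n
∈-gridEdges⁺ i<n x<n = ∈-filter-×⁺ (uncurry E?) (∈-upTo⁺ i<n) (∈-upTo⁺ x<n)

∈-gridEdges⁻ : ∀ {n i x} → (i , x) ∈ gridEdges n → i < n × x < n × E i x
∈-gridEdges⁻ {n} ix∈ with ∈-filter⁻ (uncurry E?) {xs = cartesianProduct (upTo n) (upTo n)} ix∈
... | ix∈× , e with ∈-cartesianProduct⁻ (upTo n) (upTo n) ix∈×
... | i∈ , x∈ = ∈-upTo⁻ i∈ , ∈-upTo⁻ x∈ , e

gridEdges-unique : ∀ n → Unique (gridEdges n)
gridEdges-unique n = unique-filter-× (uncurry E?) (Unique.upTo⁺ n) (Unique.upTo⁺ n)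

-- Counting edges period by period

shift : ℕ × ℕ → ℕ × ℕ
shift (i , x) = 4 + i , 4 + x

shift-injective : ∀ {e f} → shift e ≡ shift f → e ≡ f
shift-injective refl = refl

First : ℕ × ℕ → Set
First (i , x) = E i x × (i < 4 ⊎ x < 4)

first? : ∀ z → Dec (First z)
first? (i , x) = E? i x ×-dec (i ℕ.<? 4 ⊎-dec x ℕ.<? 4)

-- The range 6 suffices: when one end has index at most 3, the other has index at most 5.
firstEdges : List (ℕ × ℕ)
firstEdges = filter first? (cartesianProduct (upTo 6) (upTo 6))

firstEdges-unique : Unique firstEdges
firstEdges-unique = unique-filter-× first? (Unique.upTo⁺ 6) (Unique.upTo⁺ 6)

∈-firstEdges⁻ : ∀ {i x} → (i , x) ∈ firstEdges → i < 6 × x < 6 × First (i , x)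
∈-firstEdges⁻ ix∈ with ∈-filter⁻ first? {xs = cartesianProduct (upTo 6) (upTo 6)} ix∈
... | ix∈× , f with ∈-cartesianProduct⁻ (upTo 6) (upTo 6) ix∈×
... | i∈ , x∈ = ∈-upTo⁻ i∈ , ∈-upTo⁻ x∈ , f

∈-firstEdges⁺ : ∀ {i x} → First (i , x) → (i , x) ∈ firstEdges
∈-firstEdges⁺ (e , inj₁ i<4) = ∈-filter-×⁺ first?
  (∈-upTo⁺ (≤-trans i<4 (m≤n+m 4 2)))
  (∈-upTo⁺ (≤-trans (s≤s (E⇒x≤2+i e)) (+-monoʳ-≤ 2 i<4)))
  (e , inj₁ i<4)
∈-firstEdges⁺ (e , inj₂ x<4) = ∈-filter-×⁺ first?
  (∈-upTo⁺ (≤-trans (s≤s (E⇒i≤2+x e)) (+-monoʳ-≤ 2 x<4)))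
  (∈-upTo⁺ (≤-trans x<4 (m≤n+m 4 2)))
  (e , inj₂ x<4)

-- `E (4 + j) (4 + y)` reduces to `E j y`, since both the distance and the remainder mod 4 compute
-- past four successors; hence `e` itself is reused.
first-or-shifted : ∀ {i x} → E i x →
                   First (i , x) ⊎ (∃[ j ] ∃[ y ] (E j y × (i , x) ≡ shift (j , y)))
first-or-shifted {i} {x} e with i ℕ.<? 4 | x ℕ.<? 4
... | yes i<4 | _       = inj₁ (e , inj₁ i<4)
... | no _    | yes x<4 = inj₁ (e , inj₂ x<4)
... | no i≮4  | no x≮4
  with j , refl ← m≤n⇒∃[o]m+o≡n (≮⇒≥ i≮4) | y , refl ← m≤n⇒∃[o]m+o≡n (≮⇒≥ x≮4) =
  inj₂ (j , y , e , refl)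

-- The edges with an end below 4 are split off and the others are shifts of the smaller grid. The
-- bound 2 ≤ n makes room for the indices up to 5 in `firstEdges`.
length-gridEdges-step : ∀ n → 2 ≤ n → length (gridEdges (4 + n)) ≡ 18 + length (gridEdges n)
length-gridEdges-step n 2≤n = trans
  (≤-antisym (unique-⊆⇒length≤ (gridEdges-unique (4 + n)) to)
             (unique-⊆⇒length≤ parts-unique from))
  -- `length firstEdges` evaluates to 18: 15 edges with i < 4, and 3 more with only x < 4.
  (trans (length-++ firstEdges {map shift (gridEdges n)}) (cong (λ l → 18 + l) (length-map shift (gridEdges n))))
  where
  parts : List (ℕ × ℕ)
  parts = firstEdges ++ map shift (gridEdges n)

  parts-unique : Unique parts
  parts-unique = Unique.++⁺ firstEdges-unique
    (Unique.map⁺ shift-injective (gridEdges-unique n)) disjoint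
    where
    disjoint : ∀ {z} → z ∈ firstEdges × z ∈ map shift (gridEdges n) → ⊥
    disjoint (z∈f , z∈s) with _ , _ , refl ← ∈-map⁻ shift z∈s with ∈-firstEdges⁻ z∈f
    ... | _ , _ , _ , inj₁ i<4 = m+n≮m 4 _ i<4
    ... | _ , _ , _ , inj₂ x<4 = m+n≮m 4 _ x<4

  to : gridEdges (4 + n) ⊆ parts
  to z∈ with i<n , x<n , e ← ∈-gridEdges⁻ {4 + n} z∈ with first-or-shifted e
  ... | inj₁ f = ∈-++⁺ˡ (∈-firstEdges⁺ f)
  ... | inj₂ (j , y , e′ , refl) = ∈-++⁺ʳ firstEdges (∈-map⁺ shift
    (∈-gridEdges⁺ (+-cancelˡ-< 4 j n i<n) (+-cancelˡ-< 4 y n x<n) e′))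

  from : parts ⊆ gridEdges (4 + n)
  from z∈ with ∈-++⁻ firstEdges z∈
  ... | inj₁ z∈f with i<6 , x<6 , e , _ ← ∈-firstEdges⁻ z∈f =
    ∈-gridEdges⁺ (≤-trans i<6 (+-monoʳ-≤ 4 2≤n)) (≤-trans x<6 (+-monoʳ-≤ 4 2≤n)) e
  ... | inj₂ z∈s with (j , y) , jy∈ , refl ← ∈-map⁻ shift z∈s
                 with j<n , y<n , e ← ∈-gridEdges⁻ {n} jy∈ =
    ∈-gridEdges⁺ (+-monoʳ-< 4 j<n) (+-monoʳ-< 4 y<n) e

-- Vertices per layer for 2N + 2 copies: two copies sharing an edge span 5 indices, and each further
-- pair of copies adds one period of 4.
size : ℕ → ℕ
size zero    = 5
size (suc N) = 4 + size N

5≤size : ∀ N → 5 ≤ size N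
5≤size zero    = ≤-refl
5≤size (suc N) = m≤n⇒m≤o+n 4 (5≤size N)

N<size : ∀ N → N < size N
N<size zero    = s≤s z≤n
N<size (suc N) = s≤s (m≤n⇒m≤o+n 3 (N<size N))

-- The edge count with denominators and subtraction cleared. A period adds 18 edges and 8 vertices,
-- and 4 · 18 = 9 · 8.
4∣gridEdges∣+18≡9n : ∀ N → 4 ℕ.* length (gridEdges (size N)) + 18 ≡ 9 ℕ.* (size N + size N)
4∣gridEdges∣+18≡9n zero    = refl
4∣gridEdges∣+18≡9n (suc N) = begin
  4 ℕ.* length (gridEdges (4 + size N)) + 18
    ≡⟨ cong (λ l → 4 ℕ.* l + 18)
         (length-gridEdges-step (size N) (≤-trans (m≤n+m 2 3) (5≤size N))) ⟩
  4 ℕ.* (18 + l) + 18                         ≡⟨ left l ⟩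
  72 + (4 ℕ.* l + 18)                         ≡⟨ cong (λ l → 72 + l) (4∣gridEdges∣+18≡9n N) ⟩
  72 + 9 ℕ.* (size N + size N)                ≡⟨ right (size N) ⟩
  9 ℕ.* (4 + size N + (4 + size N))           ∎
  where
  open ≡-Reasoning
  l = length (gridEdges (size N))
  left : ∀ l → 4 ℕ.* (18 + l) + 18 ≡ 72 + (4 ℕ.* l + 18)
  left = solve-∀
  right : ∀ s → 72 + 9 ℕ.* (s + s) ≡ 9 ℕ.* (4 + s + (4 + s))
  right = solve-∀

-- Crossings in the infinite pattern

Crossℕ : Rel (ℕ × ℕ) 0ℓ
Crossℕ (i , x) (j , y) = (i < j × y < x) ⊎ (j < i × x < y)

crossℕ? : Decidable Crossℕ
crossℕ? (i , x) (j , y) = (i ℕ.<? j ×-dec y ℕ.<? x) ⊎-dec (j ℕ.<? i ×-dec x ℕ.<? y)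

crossℕ-sym : ∀ {e f} → Crossℕ e f → Crossℕ f e
crossℕ-sym (inj₁ (i<j , y<x)) = inj₂ (i<j , y<x)
crossℕ-sym (inj₂ (j<i , x<y)) = inj₁ (j<i , x<y)

-- When i < j and y < x, pass through the crossing: j ≤ 2 + y ≤ 1 + x ≤ 3 + i. The other case is
-- symmetric.
cross-local : ∀ {i x j y} → E i x → E j y → Crossℕ (i , x) (j , y) → j ≤ 3 + i × y ≤ 3 + x
cross-local e f (inj₁ (i<j , y<x)) =
  ≤-trans (E⇒i≤2+x f) (≤-trans (s≤s y<x) (s≤s (E⇒x≤2+i e))) ,
  ≤-trans (<⇒≤ y<x) (m≤n+m _ 3)
cross-local e f (inj₂ (j<i , x<y)) =
  ≤-trans (<⇒≤ j<i) (m≤n+m _ 3) ,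
  ≤-trans (E⇒x≤2+i f) (≤-trans (s≤s j<i) (s≤s (E⇒i≤2+x e)))

-- Stated for the infinite pattern, so that it is independent of the grid and can be shifted; a
-- short covering list stands in for a count over infinitely many edges.
CrossedAtMost5 : ℕ × ℕ → Set
CrossedAtMost5 e = Σ[ L ∈ List (ℕ × ℕ) ]
  (length L ≤ 5 × (∀ {j y} → E j y → Crossℕ e (j , y) → (j , y) ∈ L))

-- A finite check by evaluation. By `cross-local`, edges crossing one with indices at most 9 have
-- indices at most 12, so the grid of side 13 sees them all.
crossedAtMost5-initial : ∀ {i x} → i < 10 → x < 10 → E i x → CrossedAtMost5 (i , x)
crossedAtMost5-initial {i} {x} i<10 x<10 e =
  filter (crossℕ? (i , x)) (gridEdges 13) , toWitness {a? = bound?} _ i<10 x<10 e ,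
  λ f c → let j≤ , y≤ = cross-local e f c in
    ∈-filter⁺ (crossℕ? (i , x))
      (∈-gridEdges⁺ (≤-trans (s≤s j≤) (+-monoʳ-≤ 3 i<10)) (≤-trans (s≤s y≤) (+-monoʳ-≤ 3 x<10)) f) c
  where
  bound? : Dec (∀ {i} → i < 10 → ∀ {x} → x < 10 → E i x →
                length (filter (crossℕ? (i , x)) (gridEdges 13)) ≤ 5)
  bound? = allUpTo? (λ i → allUpTo? (λ x → E? i x →-dec (_ ℕ.≤? 5)) 10) 10

-- Edges crossing an edge with both ends at index ≥ 8 have both ends at index ≥ 4
-- (cross-local), so the bound there is inherited by shift invariance.
crossedAtMost5 : ∀ i x → E i x → CrossedAtMost5 (i , x)
crossedAtMost5 i x = go i x (<-wellFounded i)
  where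
  go : ∀ i x → Acc _<_ i → E i x → CrossedAtMost5 (i , x)
  go i x (acc rs) e with i ℕ.<? 8 | x ℕ.<? 8
  ... | yes i<8 | _       = crossedAtMost5-initial
    (≤-trans i<8 (m≤n+m 8 2)) (≤-trans (s≤s (E⇒x≤2+i e)) (+-monoʳ-≤ 2 i<8)) e
  ... | no _    | yes x<8 = crossedAtMost5-initial
    (≤-trans (s≤s (E⇒i≤2+x e)) (+-monoʳ-≤ 2 x<8)) (≤-trans x<8 (m≤n+m 8 2)) e
  ... | no i≮8  | no x≮8
    with i′ , refl ← m≤n⇒∃[o]m+o≡n (≮⇒≥ i≮8) | x′ , refl ← m≤n⇒∃[o]m+o≡n (≮⇒≥ x≮8)
    with L , L≤5 , covers ← go (4 + i′) (4 + x′) (rs (m<n+m (4 + i′) {4} (s≤s z≤n))) e =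
    map shift L , subst (_≤ 5) (sym (length-map shift L)) L≤5 , covers′
    where
    covers′ : ∀ {j y} → E j y → Crossℕ (8 + i′ , 8 + x′) (j , y) → (j , y) ∈ map shift L
    covers′ f c
      -- Exchanging the two edges in `cross-local` bounds j and y from below, which excludes an end
      -- below 4.
      with i≤ , x≤ ← cross-local f e (crossℕ-sym {8 + i′ , 8 + x′} c) | first-or-shifted f
    ... | inj₁ (_ , inj₁ j<4) = ⊥-elim (m+n≮m 8 i′ (≤-trans (s≤s i≤) (+-monoʳ-≤ 4 (<⇒≤ j<4))))
    ... | inj₁ (_ , inj₂ y<4) = ⊥-elim (m+n≮m 8 x′ (≤-trans (s≤s x≤) (+-monoʳ-≤ 4 (<⇒≤ y<4))))
    ... | inj₂ (j , y , f′ , refl) = ∈-map⁺ shift (covers f′ (unshift c))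
      where
      unshift : Crossℕ (8 + i′ , 8 + x′) (4 + j , 4 + y) → Crossℕ (4 + i′ , 4 + x′) (j , y)
      unshift (inj₁ (a , b)) = inj₁ (+-cancelˡ-< 4 _ _ a , +-cancelˡ-< 4 _ _ b)
      unshift (inj₂ (a , b)) = inj₂ (+-cancelˡ-< 4 _ _ a , +-cancelˡ-< 4 _ _ b)

-- The finite drawings

drawing : ∀ n → TwoLayer n n
drawing n = record
  { Edge  = λ i x → E (toℕ i) (toℕ x)
  ; edge? = λ i x → E? (toℕ i) (toℕ x)
  }

module _ (n : ℕ) where
  private
    toℕ² : Fin n × Fin n → ℕ × ℕ
    toℕ² (i , x) = toℕ i , toℕ x

    toℕ²-injective : ∀ {e f} → toℕ² e ≡ toℕ² f → e ≡ f
    toℕ²-injective eq = cong₂ _,_ (toℕ-injective (cong proj₁ eq)) (toℕ-injective (cong proj₂ eq))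

    ∈-layerEdges⁻ : ∀ {i x} → (i , x) ∈ layerEdges (drawing n) → E (toℕ i) (toℕ x)
    ∈-layerEdges⁻ = proj₂ ∘ ∈-filter⁻ (uncurry (TwoLayer.edge? (drawing n)))
                              {xs = cartesianProduct (allFin n) (allFin n)}

  length-layerEdges : length (layerEdges (drawing n)) ≡ length (gridEdges n)
  length-layerEdges = trans (sym (length-map toℕ² (layerEdges (drawing n))))
    (≤-antisym
      (unique-⊆⇒length≤ (Unique.map⁺ toℕ²-injective (layerEdges-unique (drawing n))) to)
      (unique-⊆⇒length≤ (gridEdges-unique n) from))
    where
    to : map toℕ² (layerEdges (drawing n)) ⊆ gridEdges n
    to z∈ with (i , x) , ix∈ , refl ← ∈-map⁻ toℕ² z∈ =
      ∈-gridEdges⁺ (toℕ<n i) (toℕ<n x) (∈-layerEdges⁻ ix∈)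

    from : gridEdges n ⊆ map toℕ² (layerEdges (drawing n))
    from {i , x} z∈ with i<n , x<n , e ← ∈-gridEdges⁻ {n} z∈ =
      subst (_∈ map toℕ² (layerEdges (drawing n)))
        (cong₂ _,_ (toℕ-fromℕ< i<n) (toℕ-fromℕ< x<n))
        (∈-map⁺ toℕ² (∈-filter-×⁺ (uncurry (TwoLayer.edge? (drawing n)))
          (∈-allFin (fromℕ< i<n)) (∈-allFin (fromℕ< x<n))
          (subst₂ E (sym (toℕ-fromℕ< i<n)) (sym (toℕ-fromℕ< x<n)) e)))

  -- Cutting the infinite pattern down to n indices creates no crossings: those that remain embed,
  -- via `toℕ²`, in the covering list.
  drawing-5-planar : KPlanar 5 (drawing n)
  drawing-5-planar i x e with L , L≤5 , covers ← crossedAtMost5 (toℕ i) (toℕ x) e = begin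
    length crossing             ≡⟨ length-map toℕ² crossing ⟨
    length (map toℕ² crossing)  ≤⟨ unique-⊆⇒length≤ unique sub ⟩
    length L                    ≤⟨ L≤5 ⟩
    5                           ∎
    where
    open ≤-Reasoning
    crossing = filter (cross? (i , x)) (layerEdges (drawing n))

    unique : Unique (map toℕ² crossing)
    unique = Unique.map⁺ toℕ²-injective
      (Unique.filter⁺ (cross? (i , x)) (layerEdges-unique (drawing n)))

    sub : map toℕ² crossing ⊆ L
    sub z∈ with f , f∈ , refl ← ∈-map⁻ toℕ² z∈
           with f∈l , c ← ∈-filter⁻ (cross? (i , x)) {xs = layerEdges (drawing n)} f∈ =
      covers (∈-layerEdges⁻ f∈l) c

-- The edge count in rational form

-- In unnormalised rationals equality is cross-multiplication, which avoids reducing fractions with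
-- a variable numerator.
rational-edge-count : ∀ l n → 4 ℕ.* l + 18 ≡ 9 ℕ.* n →
                      (+ l) / 1 ≡ (+ 9 / 4) * (+ n / 1) - (+ 9 / 2)
rational-edge-count l n eq = ℚ.toℚᵘ-injective (begin
  toℚᵘ (+ l / 1)                                ≈⟨ ℚ.toℚᵘ-fromℚᵘ (+ l ℚᵘ./ 1) ⟩
  + l ℚᵘ./ 1                                    ≈⟨ *≡* cross-multiplied ⟩
  toℚᵘ (+ 9 / 4) ℚᵘ.* (+ n ℚᵘ./ 1) ℚᵘ.- toℚᵘ (+ 9 / 2)
    ≈⟨ ℚᵘ.+-congˡ _ (ℚᵘ.*-congˡ {toℚᵘ (+ 9 / 4)} (ℚ.toℚᵘ-fromℚᵘ (+ n ℚᵘ./ 1))) ⟨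
  toℚᵘ (+ 9 / 4) ℚᵘ.* toℚᵘ (+ n / 1) ℚᵘ.- toℚᵘ (+ 9 / 2)
    ≈⟨ ℚᵘ.+-congˡ _ (ℚ.toℚᵘ-homo-* (+ 9 / 4) (+ n / 1)) ⟨
  toℚᵘ ((+ 9 / 4) * (+ n / 1)) ℚᵘ.- toℚᵘ (+ 9 / 2)
    ≈⟨ ℚ.toℚᵘ-homo-+ ((+ 9 / 4) * (+ n / 1)) (- (+ 9 / 2)) ⟨
  toℚᵘ ((+ 9 / 4) * (+ n / 1) - (+ 9 / 2)) ∎)
  where
  open import Relation.Binary.Reasoning.Setoid ℚᵘ.≃-setoid

  9n≡4l+18 : + 9 ℤ.* + n ≡ + 4 ℤ.* + l ℤ.+ + 18
  9n≡4l+18 = trans (sym (ℤ.pos-* 9 n)) (trans (cong +_ (sym eq)) (cong (ℤ._+ + 18) (ℤ.pos-* 4 l)))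

  identity : ∀ k → k ℤ.* + 8 ≡ ((+ 4 ℤ.* k ℤ.+ + 18) ℤ.* + 2 ℤ.+ (ℤ.- + 9) ℤ.* + 4) ℤ.* + 1
  identity = ℤRing.solve-∀

  -- The right-hand side has denominator 4 · 2 = 8; replacing 9n by 4l + 18 leaves a ring identity
  -- in l.
  cross-multiplied : + l ℤ.* + 8 ≡ (+ 9 ℤ.* + n ℤ.* + 2 ℤ.+ (ℤ.- + 9) ℤ.* + 4) ℤ.* + 1
  cross-multiplied = trans (identity (+ l))
    (cong (λ m → (m ℤ.* + 2 ℤ.+ (ℤ.- + 9) ℤ.* + 4) ℤ.* + 1) (sym 9n≡4l+18))

theorem7 : (N : ℕ) →
    ∃[ n ] (N < n × (Σ[ G ∈ Graph (Fin n) ]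
    (TwoLayerKPlanar 5 G ×
    (+ length (edges G)) / 1 ≡ (+ 9 / 4) * (+ n / 1) - (+ 9 / 2))))
theorem7 N =
  size N + size N , m≤n⇒m≤o+n (size N) (N<size N) , linearGraph D ,
  linearGraph-kPlanar D (drawing-5-planar (size N)) ,
  rational-edge-count (length (edges (linearGraph D))) (size N + size N) (trans
    (cong (λ l → 4 ℕ.* l + 18) (trans (length-edges D) (length-layerEdges (size N))))
    (4∣gridEdges∣+18≡9n N))
  where
  D = drawing (size N)
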